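{- Let $B>3$ be an odd integer, and let $c_{\max}(B)$ be the largest length of a terminal cycle of the four-digit Kaprekar map in base $B$. Then $$c_{\max}(B)\le\frac{B-1}{2}.$$ Moreover, equality holds if and only if $B\ge 7$, $B$ is prime, and the least positive integer $m$ with $2^m\equiv\pm1\pmod B$ is $m=\frac{B-1}{2}$.
   Context: A four-digit string in base $B$ is a sequence of four digits in $\{0,\dots,B-1\}$ (leading zeros allowed). The four-digit Kaprekar map in base $B$ sends a string whose digits sorted in non-increasing order are $a_1\ge a_2\ge a_3\ge a_4$ to the four-digit base-$B$ string (with leading zeros if needed) of the number $$(a_1B^3+a_2B^2+a_3B+a_4)-(a_4B^3+a_3B^2+a_2B+a_1).$$ Constant strings (all four digits equal) are excluded throughout. A terminal cycle is a periodic orbit of this map consisting of nonconstant strings, and its length is the number of distinct strings in it (the minimal period). -}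

module Defs where

open import Data.Digit using (Digit; fromDigits)
open import Data.Fin.Properties using (≤-decTotalOrder)
open import Data.List.Base using (List; reverse)
open import Data.Nat.Base using (ℕ; NonZero; _+_; _*_; _∸_; _^_; _≤_; _<_)
open import Data.Nat.Divisibility using (_∣_)
open import Data.Nat.DivMod using (_/_; _mod_)
open import Data.Nat.GeneralisedArithmetic using (iterate)
open import Data.Product.Base using (∃-syntax; _×_)
open import Data.Sum.Base using (_⊎_)
open import Data.Vec.Base using (Vec; []; _∷_; toList; replicate)
open import Relation.Binary.Construct.Flip.EqAndOrd using (decTotalOrder)
open import Relation.Binary.PropositionalEquality using (_≡_)
open import Relation.Nullary.Negation using (¬_)
import Data.List.Sort.InsertionSort as InsertionSort

IsLeast : (ℕ → Set) → ℕ → Set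
IsLeast P m = P m × (∀ n → P n → m ≤ n)

IsLargest : (ℕ → Set) → ℕ → Set
IsLargest P m = P m × (∀ n → P n → n ≤ m)

-- Strings are written most significant digit first.
DigitString : ℕ → Set
DigitString B = Vec (Digit B) 4

NonConstant : ∀ {B} → DigitString B → Set
NonConstant s = ¬ (∃[ d ] s ≡ replicate 4 d)

sortNonIncreasing : ∀ {B} → List (Digit B) → List (Digit B)
sortNonIncreasing {B} = InsertionSort.sort (decTotalOrder (≤-decTotalOrder B))

-- The last four base-B digits of n, which are all of them when n < B ^ 4.
toDigitString : ∀ B .{{_ : NonZero B}} → ℕ → DigitString B
toDigitString B n =
  (n / B / B / B) mod B ∷ (n / B / B) mod B ∷ (n / B) mod B ∷ n mod B ∷ []

-- fromDigits reads the least significant digit first, so for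
-- as = a₁ ≥ a₂ ≥ a₃ ≥ a₄ the minuend is a₁B³ + a₂B² + a₃B + a₄ and the
-- subtrahend is a₄B³ + a₃B² + a₂B + a₁; the former is at least the latter,
-- so _∸_ does not truncate.
kaprekar : ∀ B .{{_ : NonZero B}} → DigitString B → DigitString B
kaprekar B s = toDigitString B (fromDigits (reverse as) ∸ fromDigits as)
  where
  as : List (Digit B)
  as = sortNonIncreasing (toList s)

IsPeriod : {A : Set} → (A → A) → A → ℕ → Set
IsPeriod f x k = 0 < k × iterate f x k ≡ x

-- k is the length of some terminal cycle; s is any string on the cycle.
IsTerminalCycleLength : ∀ B .{{_ : NonZero B}} → ℕ → Set
IsTerminalCycleLength B k =
  ∃[ s ] (∀ i → NonConstant (iterate (kaprekar B) s i))
       × IsLeast (IsPeriod (kaprekar B) s) k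

-- 2 ^ m ≡ ±1 (mod B); since 2 ^ m ≥ 1 the subtraction does not truncate.
TwoPower≡±1 : ℕ → ℕ → Set
TwoPower≡±1 B m = B ∣ 2 ^ m ∸ 1 ⊎ B ∣ 2 ^ m + 1

{-# OPTIONS --safe #-}
module Submission where

-- The map acts on the gaps x = a₁ − a₄ and y = a₂ − a₃ of the sorted digits:
-- the image has the digits x, y − 1, B − 1 − y, B − x, hence, as a rule, the
-- gaps ∣ B - 2x ∣ and ∣ B - 2y ∣ in decreasing order.  After finitely many steps
-- the gaps are two distinct odd numbers below B, and from then on each gap is
-- doubled modulo B up to sign.  So every cycle length is at most the least
-- m > 0 with 2 ^ m ≡ ±1, and for B ≥ 7 the gaps 1 and B − 2 attain m.  Doubling
-- permutes the (B − 1) / 2 odd digits, so m ≤ (B − 1) / 2; in case of equality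
-- the orbit of 1 consists of all odd digits, which are then units, so B is
-- prime.  For B = 5 the only pair is {1, 3}, which doubling swaps, so the
-- largest cycle length is 1 although m = 2.

open import Defs
open import Data.Digit using (Digit; fromDigits)
open import Data.Fin.Base using (Fin; zero; suc; toℕ; fromℕ<)
open import Data.Fin.Properties
  using (toℕ-fromℕ<; toℕ<n; toℕ≤pred[n]; fromℕ<-injective; pigeonhole)
import Data.Fin.Properties as Fin
open import Data.Integer.Base as ℤ using ()
import Data.Integer.Divisibility.Signed as ℤ
import Data.Integer.Properties as ℤ
import Data.Integer.Tactic.RingSolver as ℤ-Solver
open import Data.List.Base using (List; []; _∷_; map; reverse; length)
open import Data.List.Properties using (reverse-map; ∷-injective)
open import Data.List.Relation.Binary.Permutation.Propositional
  using (_↭_; ↭-refl; ↭-trans; ↭-reflexive; ↭⇒↭ₛ; prep; swap)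
open import Data.List.Relation.Binary.Permutation.Propositional.Properties
  using (map⁺; ++⁺; ++-comm; ↭-length)
import Data.List.Relation.Binary.Pointwise as Pointwise
open import Data.List.Relation.Unary.All using (All; []; _∷_)
open import Data.List.Relation.Unary.Linked using (Linked; [-]; _∷_)
import Data.List.Relation.Unary.Linked.Properties as Linked
open import Data.List.Relation.Unary.Sorted.TotalOrder.Properties using (↗↭↗⇒≋)
open import Data.List.Sort.Base using (module SortingAlgorithm)
import Data.List.Sort.InsertionSort as InsertionSort
open import Data.Nat.Base
  using (ℕ; zero; suc; NonZero; _+_; _*_; _∸_; _^_; _≤_; _<_; _>_; _≥_; _⊔_; _⊓_;
         ∣_-_∣; z≤n; s≤s; n>1⇒nonTrivial; nonTrivial⇒n>1)
open import Data.Nat.Divisibility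
  using (_∣_; _∤_; divides; ∣-trans; ∣-reflexive; ∣⇒≤; ∣1⇒≡1; m%n≡0⇒n∣m; m∣m*n; n∣m*n;
         ∣n⇒∣m*n; ∣m∣n⇒∣m+n; ∣m+n∣m⇒∣n)
open import Data.Nat.DivMod
  using (_/_; _%_; _mod_; m%n<n; m≡m%n+[m/n]*n; m*n/n≡m; m<n⇒m%n≡m; m<n⇒m/n≡0; 0/n≡0;
         [m+kn]%n≡m%n; +-distrib-/-∣ˡ)
open import Data.Nat.GeneralisedArithmetic using (iterate)
open import Data.Nat.Primality using (Composite; Prime; prime; composite)
open import Data.Nat.Properties
open import Data.Nat.Tactic.RingSolver using (solve-∀)
open import Data.Product.Base using (∃-syntax; _×_; _,_; proj₁; proj₂)
open import Data.Sum.Base using (_⊎_; inj₁; inj₂)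
open import Data.Vec.Base using ([]; _∷_; replicate; toList)
open import Function.Bundles using (_⇔_; mk⇔; module Equivalence)
open import Relation.Binary.Bundles using (DecTotalOrder; TotalOrder)
open import Relation.Binary.Construct.Flip.EqAndOrd using (decTotalOrder)
open import Relation.Binary.Definitions using (tri<; tri≈; tri>)
open import Relation.Binary.PropositionalEquality
  using (_≡_; _≢_; refl; sym; trans; cong; cong₂; subst; subst₂; module ≡-Reasoning)
open import Relation.Nullary.Decidable using (Dec; yes; no; _×-dec_)
open import Relation.Nullary.Negation using (¬_; contradiction)

private variable
  B : ℕ

-- Sorted digit lists

Descending : List ℕ → Set
Descending = Linked _≥_

private
  ≥-totalOrder : TotalOrder _ _ _
  ≥-totalOrder = DecTotalOrder.totalOrder (decTotalOrder ≤-decTotalOrder)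

  module DigitSort {B} = SortingAlgorithm (InsertionSort.insertionSort (decTotalOrder (Fin.≤-decTotalOrder B)))

descending-unique : ∀ {ms ns} → Descending ms → Descending ns → ms ↭ ns → ms ≡ ns
descending-unique ms↘ ns↘ ms↭ns =
  Pointwise.Pointwise-≡⇒≡ (↗↭↗⇒≋ ≥-totalOrder ms↘ ns↘ (↭⇒↭ₛ ms↭ns))

digitValues : DigitString B → List ℕ
digitValues s = map toℕ (toList s)

sortedValues : DigitString B → List ℕ
sortedValues s = map toℕ (sortNonIncreasing (toList s))

sortedValues-↭ : ∀ (s : DigitString B) → sortedValues s ↭ digitValues s
sortedValues-↭ s = map⁺ toℕ (DigitSort.sort-↭ (toList s))

sortedValues-descending : ∀ (s : DigitString B) → Descending (sortedValues s)
sortedValues-descending s = Linked.map⁺ (DigitSort.sort-↗ (toList s))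

sortedValues≡ : ∀ (s : DigitString B) {ns} → Descending ns → digitValues s ↭ ns → sortedValues s ≡ ns
sortedValues≡ s ns↘ s↭ns =
  descending-unique (sortedValues-descending s) ns↘ (↭-trans (sortedValues-↭ s) s↭ns)

-- Gaps of the sorted digits

-- The additive form of the sorted digits avoids truncated subtraction. The two lower digits `c` and
-- `d` are fields rather than parameters because the Kaprekar image depends on `x` and `y` alone.
record Gaps (s : DigitString B) (x y : ℕ) : Set where
  constructor gaps
  field
    {c d}  : ℕ
    sorted : sortedValues s ≡ d + x ∷ c + y ∷ c ∷ d ∷ []

gaps-unique : ∀ {s : DigitString B} {x y x′ y′} → Gaps s x y → Gaps s x′ y′ → x ≡ x′ × y ≡ y′
gaps-unique (gaps p) (gaps q) with trans (sym p) q
... | eq with ∷-injective eq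
... | ex , eq₁ with ∷-injective eq₁
... | ey , refl = +-cancelˡ-≡ _ _ _ ex , +-cancelˡ-≡ _ _ _ ey

gaps-fromPermutation : ∀ (s : DigitString B) {x y} c d → digitValues s ↭ d + x ∷ c + y ∷ c ∷ d ∷ [] →
  c + y ≤ d + x → d ≤ c → Gaps s x y
gaps-fromPermutation s c d s↭ c+y≤d+x d≤c =
  gaps (sortedValues≡ s (c+y≤d+x ∷ m≤m+n c _ ∷ d≤c ∷ [-]) s↭)

toℕs<B : ∀ (ds : List (Digit B)) → All (_< B) (map toℕ ds)
toℕs<B []       = []
toℕs<B (d ∷ ds) = toℕ<n d ∷ toℕs<B ds

hasGaps : ∀ (s : DigitString B) → ∃[ x ] ∃[ y ] Gaps s x y
hasGaps s@(_ ∷ _ ∷ _ ∷ _ ∷ []) = four (sortedValues-descending s) refl (↭-length (sortedValues-↭ s))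
  where
  -- The sorted list is generalised to a variable `ns`, which can be split by matching; its length
  -- excludes every shape but four entries.
  four : ∀ {ns} → Descending ns → sortedValues s ≡ ns → length (sortedValues s) ≡ 4 → ∃[ x ] ∃[ y ] Gaps s x y
  four {a ∷ b ∷ c ∷ d ∷ []} (a≥b ∷ b≥c ∷ c≥d ∷ [-]) eq _ =
    a ∸ d , b ∸ c , gaps (trans eq (cong₂ (λ a b → a ∷ b ∷ c ∷ d ∷ [])
      (sym (m+[n∸m]≡n (≤-trans c≥d (≤-trans b≥c a≥b)))) (sym (m+[n∸m]≡n b≥c))))
  four {[]}                    _ eq len = contradiction (trans (sym (cong length eq)) len) λ ()
  four {_ ∷ []}                _ eq len = contradiction (trans (sym (cong length eq)) len) λ ()
  four {_ ∷ _ ∷ []}            _ eq len = contradiction (trans (sym (cong length eq)) len) λ ()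
  four {_ ∷ _ ∷ _ ∷ []}        _ eq len = contradiction (trans (sym (cong length eq)) len) λ ()
  four {_ ∷ _ ∷ _ ∷ _ ∷ _ ∷ _} _ eq len = contradiction (trans (sym (cong length eq)) len) λ ()

outer<B : ∀ {s : DigitString B} {x y} → Gaps s x y → x < B
outer<B {s = s} (gaps {d = d} eq) with subst (All (_< _)) eq (toℕs<B (sortNonIncreasing (toList s)))
... | d+x<B ∷ _ = ≤-<-trans (m≤n+m _ d) d+x<B

inner≤outer : ∀ {s : DigitString B} {x y} → Gaps s x y → y ≤ x
inner≤outer {s = s} {x} {y} (gaps {c} {d} eq) with subst Descending eq (sortedValues-descending s)
... | c+y≤d+x ∷ _ ∷ d≤c ∷ _ = +-cancelˡ-≤ d y x (≤-trans (+-monoˡ-≤ y d≤c) c+y≤d+x)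

-- The map as a function of the gaps

evaluate : ℕ → List ℕ → ℕ
evaluate B []       = 0
evaluate B (n ∷ ns) = n + evaluate B ns * B

fromDigits≡evaluate : ∀ (ds : List (Digit B)) → fromDigits ds ≡ evaluate B (map toℕ ds)
fromDigits≡evaluate []           = refl
fromDigits≡evaluate {B} (d ∷ ds) = cong (λ n → toℕ d + n * B) (fromDigits≡evaluate ds)

-- In the difference the lower digits `c` and `d` cancel, which leaves x(B³ - 1) + y(B² - B). The
-- number `n` is specified by an equation without subtraction, so that a candidate given by its
-- digits can be checked by ring identities.
kaprekar≡ : .{{_ : NonZero B}} → ∀ {s : DigitString B} {x y} → Gaps s x y →
  ∀ n → n + (x + y * B) ≡ x * B ^ 3 + y * B ^ 2 → kaprekar B s ≡ toDigitString B n
kaprekar≡ {B} {s} {x} {y} (gaps {c} {d} eq) n n+≡ = cong (toDigitString B) (begin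
  fromDigits (reverse as) ∸ fromDigits as
    ≡⟨ cong₂ _∸_ (fromDigits≡evaluate (reverse as)) (fromDigits≡evaluate as) ⟩
  evaluate B (map toℕ (reverse as)) ∸ evaluate B (map toℕ as)
    ≡⟨ cong (λ ns → evaluate B ns ∸ evaluate B (map toℕ as)) (reverse-map toℕ as) ⟩
  evaluate B (reverse (map toℕ as)) ∸ evaluate B (map toℕ as)
    ≡⟨ cong (λ ns → evaluate B (reverse ns) ∸ evaluate B ns) eq ⟩
  minuend ∸ subtrahend
    ≡⟨ cong (_∸ subtrahend) (minuend≡ d c x y B) ⟩
  rest + (x * B ^ 3 + y * B ^ 2) ∸ subtrahend
    ≡⟨ cong (λ k → rest + k ∸ subtrahend) n+≡ ⟨
  rest + (n + (x + y * B)) ∸ subtrahend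
    ≡⟨ cong (_∸ subtrahend) (subtrahend≡ d c x y B n) ⟩
  n + subtrahend ∸ subtrahend
    ≡⟨ m+n∸n≡m n subtrahend ⟩
  n ∎)
  where
  open ≡-Reasoning
  as = sortNonIncreasing (toList s)
  minuend    = evaluate B (d ∷ c ∷ c + y ∷ d + x ∷ [])
  subtrahend = evaluate B (d + x ∷ c + y ∷ c ∷ d ∷ [])
  rest       = d + c * B + c * B ^ 2 + d * B ^ 3
  -- The ring solver does not know _^_, so powers of B are written unfolded.
  minuend≡ : ∀ d c x y B → d + (c + ((c + y) + ((d + x) + 0 * B) * B) * B) * B
    ≡ (d + c * B + c * (B * (B * 1)) + d * (B * (B * (B * 1)))) + (x * (B * (B * (B * 1))) + y * (B * (B * 1)))
  minuend≡ = solve-∀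
  subtrahend≡ : ∀ d c x y B n → (d + c * B + c * (B * (B * 1)) + d * (B * (B * (B * 1)))) + (n + (x + y * B))
    ≡ n + ((d + x) + ((c + y) + (c + (d + 0 * B) * B) * B) * B)
  subtrahend≡ = solve-∀

-- This reduces the dynamics to gaps: strings whose gaps agree coincide after one step.
kaprekar-cong : .{{_ : NonZero B}} → ∀ {s t : DigitString B} {x y} → Gaps s x y → Gaps t x y →
  kaprekar B s ≡ kaprekar B t
kaprekar-cong {B} {x = x} {y} gs gt = trans (kaprekar≡ gs n n+≡) (sym (kaprekar≡ gt n n+≡))
  where
  n = x * B ^ 3 + y * B ^ 2 ∸ (x + y * B)
  n+≡ : n + (x + y * B) ≡ x * B ^ 3 + y * B ^ 2
  n+≡ = m∸n+n≡m (+-mono-≤ (m≤m*n x (B ^ 3) {{m^n≢0 B 3}})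
    (*-monoʳ-≤ y (≤-trans (m≤m*n B B) (≤-reflexive (cong (B *_) (sym (*-identityʳ B)))))))

[m*n+o]/n≡m : ∀ m {n o} .{{_ : NonZero n}} → o < n → (m * n + o) / n ≡ m
[m*n+o]/n≡m m {n} {o} o<n = trans (+-distrib-/-∣ˡ o (n∣m*n m))
  (trans (cong₂ _+_ (m*n/n≡m m n) (m<n⇒m/n≡0 o<n)) (+-identityʳ m))

toℕ-[m*n+o]mod-n : ∀ m {n o} .{{_ : NonZero n}} → o < n → toℕ ((m * n + o) mod n) ≡ o
toℕ-[m*n+o]mod-n m {n} {o} o<n = trans (toℕ-fromℕ< (m%n<n (m * n + o) n))
  (trans (cong (_% n) (+-comm (m * n) o)) (trans ([m+kn]%n≡m%n o m n) (m<n⇒m%n≡m o<n)))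

-- In Horner form each division by `B` strips off exactly the last digit.
digitValues-toDigitString : .{{_ : NonZero B}} → ∀ {p q r t} → p < B → q < B → r < B → t < B →
  digitValues (toDigitString B (((p * B + q) * B + r) * B + t)) ≡ p ∷ q ∷ r ∷ t ∷ []
digitValues-toDigitString {B} {p} {q} {r} {t} p<B q<B r<B t<B
  rewrite [m*n+o]/n≡m ((p * B + q) * B + r) t<B
        | [m*n+o]/n≡m (p * B + q) r<B
        | [m*n+o]/n≡m p q<B
        | toℕ-[m*n+o]mod-n ((p * B + q) * B + r) t<B
        | toℕ-[m*n+o]mod-n (p * B + q) r<B
        | toℕ-[m*n+o]mod-n p q<B
        | toℕ-fromℕ< (m%n<n p B)
        | m<n⇒m%n≡m p<B
        = refl

constant⇒outer≡0 : ∀ {s : DigitString B} {d x y} → s ≡ replicate 4 d → Gaps s x y → x ≡ 0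
constant⇒outer≡0 {d = d} refl g = sym (proj₁ (gaps-unique
  (gaps-fromPermutation (replicate 4 d) (toℕ d) (toℕ d) (↭-reflexive
    (cong₂ (λ m n → m ∷ n ∷ toℕ d ∷ toℕ d ∷ []) (sym (+-identityʳ _)) (sym (+-identityʳ _))))
    ≤-refl ≤-refl) g))

-- The inner gap is at most the outer one, so both vanish and the difference is 0. This excludes
-- outer gap 0 on a terminal cycle.
kaprekar-constant : .{{_ : NonZero B}} → ∀ {s : DigitString B} {y} → Gaps s 0 y →
  ∃[ d ] kaprekar B s ≡ replicate 4 d
kaprekar-constant {B} {s} g with inner≤outer g
... | z≤n = 0 mod B , trans (kaprekar≡ g 0 refl) zeros
  where
  0/B≡0 : 0 / B ≡ 0
  0/B≡0 = 0/n≡0 B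
  zeros : toDigitString B 0 ≡ replicate 4 (0 mod B)
  -- Each rewrite removes one level of the nested divisions, of which there are at most three.
  zeros rewrite 0/B≡0 | 0/B≡0 | 0/B≡0 = refl

-- One step of the map

-- For a ≤ B this is the distance between a and B - a, which is how it arises as a gap of the image.
twice± : ℕ → ℕ → ℕ
twice± B a = ∣ B - 2 * a ∣

m⊔n≡m⊓n+∣m-n∣ : ∀ m n → m ⊔ n ≡ m ⊓ n + ∣ m - n ∣
m⊔n≡m⊓n+∣m-n∣ zero    n       = refl
m⊔n≡m⊓n+∣m-n∣ (suc m) zero    = refl
m⊔n≡m⊓n+∣m-n∣ (suc m) (suc n) = cong suc (m⊔n≡m⊓n+∣m-n∣ m n)

m⊓n+m⊔n≡m+n : ∀ m n → m ⊓ n + (m ⊔ n) ≡ m + n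
m⊓n+m⊔n≡m+n zero    n       = refl
m⊓n+m⊔n≡m+n (suc m) zero    = sym (+-identityʳ (suc m))
m⊓n+m⊔n≡m+n (suc m) (suc n) = cong suc (trans (+-suc (m ⊓ n) (m ⊔ n))
  (trans (cong suc (m⊓n+m⊔n≡m+n m n)) (sym (+-suc m n))))

pair-↭ : ∀ m n → m ∷ n ∷ [] ↭ m ⊔ n ∷ m ⊓ n ∷ []
pair-↭ m n with ≤-total m n
... | inj₁ m≤n rewrite m≤n⇒m⊔n≡n m≤n | m≤n⇒m⊓n≡m m≤n = swap m n ↭-refl
... | inj₂ n≤m rewrite m≥n⇒m⊔n≡m n≤m | m≥n⇒m⊓n≡n n≤m = ↭-refl

-- For y = 0 the borrow runs through both middle digits, so the image has the
-- digits x − 1, B − 1, B − 1, B − x.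
kaprekar-zero : .{{_ : NonZero B}} → ∀ {s : DigitString B} {p g} → Gaps s (suc p) 0 → suc p + g ≡ B →
  Gaps (kaprekar B s) (p ⊔ g) (p ⊓ g)
kaprekar-zero {B} {s} {p} {g} gs refl = gaps-fromPermutation _ (p ⊔ g) (p ⊓ g)
  (↭-trans (↭-reflexive values≡) values↭)
  (≤-reflexive (+-comm (p ⊔ g) (p ⊓ g))) (m⊓n≤m⊔n p g)
  where
  b = p + g
  number : ∀ p g → (((p * suc (p + g) + (p + g)) * suc (p + g) + (p + g)) * suc (p + g) + g) + (suc p + 0)
    ≡ suc p * (suc (p + g) * (suc (p + g) * (suc (p + g) * 1))) + 0
  number = solve-∀
  values≡ : digitValues (kaprekar B s) ≡ p ∷ b ∷ b ∷ g ∷ []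
  values≡ = trans (cong digitValues (kaprekar≡ gs _ (number p g)))
    (digitValues-toDigitString (s≤s (m≤m+n p g)) ≤-refl ≤-refl (s≤s (m≤n+m g p)))
  -- Here `b` is B - 1 = p + g, the sum of the maximum and the minimum of `p` and `g`. Subtracting
  -- the minimum from it gives the maximum as outer gap, and conversely for the inner gap.
  values↭ : p ∷ b ∷ b ∷ g ∷ [] ↭ p ⊓ g + (p ⊔ g) ∷ p ⊔ g + (p ⊓ g) ∷ p ⊔ g ∷ p ⊓ g ∷ []
  values↭ rewrite +-comm (p ⊔ g) (p ⊓ g) | m⊓n+m⊔n≡m+n p g =
    ↭-trans (swap p b (↭-trans (swap b g ↭-refl) ↭-refl)) (prep b (↭-trans (prep p (swap g b ↭-refl))
      (↭-trans (swap p b ↭-refl) (prep b (pair-↭ p g)))))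

twice±-outer : ∀ x g → twice± (x + g) x ≡ ∣ x - g ∣
twice±-outer x g = trans (cong (∣ x + g -_∣) (cong (x +_) (+-identityʳ x)))
  (trans (∣m+n-m+o∣≡∣n-o∣ x g x) (∣-∣-comm g x))

-- The inner digits `w` = y - 1 and `e` = B - 1 - y are y and B - y, both lowered by one, so the
-- formula for the outer digits applies.
twice±-inner : ∀ w e → twice± (suc (suc (w + e))) (suc w) ≡ ∣ w - e ∣
twice±-inner w e = trans (cong (λ k → twice± k (suc w)) (cong suc (sym (+-suc w e))))
  (twice±-outer (suc w) (suc e))

m+n≡m⊓n+m⊓n+∣m-n∣ : ∀ m n → m + n ≡ m ⊓ n + (m ⊓ n + ∣ m - n ∣)
m+n≡m⊓n+m⊓n+∣m-n∣ m n = trans (sym (m⊓n+m⊔n≡m+n m n)) (cong (m ⊓ n +_) (m⊔n≡m⊓n+∣m-n∣ m n))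

-- The digits x, y − 1, B − 1 − y, B − x form two pairs, with sums B and B − 2
-- and with differences ∣ B - 2x ∣ and ∣ B - 2y ∣.
kaprekar-positive-↭ : .{{_ : NonZero B}} → ∀ {s : DigitString B} {x y} → Gaps s x y → 0 < x → 0 < y →
  ∃[ p ] ∃[ q ] B ≡ p + (p + twice± B x) × B ≡ suc (suc (q + (q + twice± B y)))
    × digitValues (kaprekar B s) ↭ p + twice± B x ∷ p ∷ q + twice± B y ∷ q ∷ []
kaprekar-positive-↭ {B} {s} {x@(suc x′)} {suc w} gs _ _ =
  x ⊓ g , w ⊓ e ,
  trans (sym x+g≡B) (trans (m+n≡m⊓n+m⊓n+∣m-n∣ x g) (cong (λ k → x ⊓ g + (x ⊓ g + k)) (sym u≡))) ,
  trans (sym w+e+2≡B) (cong (λ k → suc (suc k)) (trans (m+n≡m⊓n+m⊓n+∣m-n∣ w e)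
    (cong (λ k → w ⊓ e + (w ⊓ e + k)) (sym v≡)))) ,
  ↭-trans (↭-reflexive values≡) values↭
  where
  g = B ∸ x
  e = B ∸ suc (suc w)
  x<B = outer<B gs
  x+g≡B : x + g ≡ B
  x+g≡B = m+[n∸m]≡n (<⇒≤ x<B)
  w+e+2≡B : suc (suc (w + e)) ≡ B
  w+e+2≡B = m+[n∸m]≡n (≤-<-trans (inner≤outer gs) x<B)
  u≡ : twice± B x ≡ ∣ x - g ∣
  u≡ = trans (cong (λ k → twice± k x) (sym x+g≡B)) (twice±-outer x g)
  v≡ : twice± B (suc w) ≡ ∣ w - e ∣
  v≡ = trans (cong (λ k → twice± k (suc w)) (sym w+e+2≡B)) (twice±-inner w e)
  regroup : ∀ B x w e g → (((x * B + w) * B + e) * B + g) + (x + suc w * B)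
    ≡ x * (B * (B * (B * 1))) + w * (B * (B * 1)) + ((e + w) * B + B) + (x + g)
  regroup = solve-∀
  collect : ∀ B x w → x * (B * (B * (B * 1))) + w * (B * (B * 1)) + B * B
    ≡ x * (B * (B * (B * 1))) + suc w * (B * (B * 1))
  collect = solve-∀
  carry : ∀ B e w → (e + w) * B + B + B ≡ suc (suc (w + e)) * B
  carry = solve-∀
  -- Adding the subtrahend back, x + g = B carries one B; together with the middle terms this makes
  -- (w + e + 2)B = B², which raises the coefficient `w` of B² to y = `suc w`.
  number : (((x * B + w) * B + e) * B + g) + (x + suc w * B) ≡ x * B ^ 3 + suc w * B ^ 2
  number = begin
    (((x * B + w) * B + e) * B + g) + (x + suc w * B)  ≡⟨ regroup B x w e g ⟩
    top + ((e + w) * B + B) + (x + g)                  ≡⟨ cong (top + ((e + w) * B + B) +_) x+g≡B ⟩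
    top + ((e + w) * B + B) + B                        ≡⟨ +-assoc top _ B ⟩
    top + ((e + w) * B + B + B)                        ≡⟨ cong (top +_) (carry B e w) ⟩
    top + suc (suc (w + e)) * B                        ≡⟨ cong (λ k → top + k * B) w+e+2≡B ⟩
    top + B * B                                        ≡⟨ collect B x w ⟩
    x * B ^ 3 + suc w * B ^ 2                          ∎
    where
    open ≡-Reasoning
    top = x * B ^ 3 + w * B ^ 2
  values≡ : digitValues (kaprekar B s) ≡ x ∷ w ∷ e ∷ g ∷ []
  values≡ = trans (cong digitValues (kaprekar≡ gs _ number)) (digitValues-toDigitString x<B
    (subst (w <_) w+e+2≡B (s≤s (≤-trans (m≤m+n w e) (n≤1+n _))))
    (subst (e <_) w+e+2≡B (s≤s (≤-trans (m≤n+m e w) (n≤1+n _))))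
    (subst (g <_) x+g≡B (s≤s (m≤n+m g x′))))
  values↭ : x ∷ w ∷ e ∷ g ∷ [] ↭ x ⊓ g + twice± B x ∷ x ⊓ g ∷ w ⊓ e + twice± B (suc w) ∷ w ⊓ e ∷ []
  values↭ rewrite u≡ | v≡ | sym (m⊔n≡m⊓n+∣m-n∣ x g) | sym (m⊔n≡m⊓n+∣m-n∣ w e) =
    ↭-trans (prep x (++-comm (w ∷ e ∷ []) (g ∷ []))) (++⁺ (pair-↭ x g) (pair-↭ w e))

module _ (p q u v : ℕ) (eq : p + (p + u) ≡ suc (suc (q + (q + v)))) where

  -- The pairs `p`, `p + u` and `q`, `q + v` have midpoints one apart, and by `eq` their widths have
  -- the same parity. Unequal widths thus differ by at least 2, and the wider pair encloses the
  -- narrower, so the widths themselves are the gaps of the four digits.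
  nested-outer : v < u → p ≤ q × q + v ≤ p + u
  nested-outer v<u = p≤q , +-cancelˡ-≤ p _ _ (≤-trans (+-monoˡ-≤ (q + v) p≤q)
    (≤-trans (≤-trans (n≤1+n _) (n≤1+n _)) (≤-reflexive (sym eq))))
    where
    open ≤-Reasoning
    p≤q : p ≤ q
    p≤q with ≤-<-connex p q
    ... | inj₁ p≤q = p≤q
    ... | inj₂ q<p = contradiction eq (>⇒≢ (begin-strict
      suc (suc (q + (q + v)))  ≡⟨ cong suc (+-suc q (q + v)) ⟨
      suc q + suc (q + v)      <⟨ +-monoʳ-< (suc q) (s≤s (+-monoʳ-< q v<u)) ⟩
      suc q + (suc q + u)      ≤⟨ +-mono-≤ q<p (+-monoˡ-≤ u q<p) ⟩
      p + (p + u)              ∎))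

  nested-inner : u < v → suc q < p × p + u ≤ q + v
  nested-inner u<v = 1+q<p , +-cancelˡ-≤ (suc (suc q)) _ _ (≤-trans (+-monoˡ-≤ (p + u) 1+q<p) (≤-reflexive eq))
    where
    open ≤-Reasoning
    1+q<p : suc q < p
    1+q<p with ≤-<-connex p (suc q)
    ... | inj₂ 1+q<p = 1+q<p
    ... | inj₁ p≤1+q = contradiction eq (<⇒≢ (begin-strict
      p + (p + u)              ≤⟨ +-mono-≤ p≤1+q (+-monoˡ-≤ u p≤1+q) ⟩
      suc q + (suc q + u)      <⟨ +-monoʳ-< (suc q) (s≤s (+-monoʳ-< q u<v)) ⟩
      suc q + suc (q + v)      ≡⟨ cong suc (+-suc q (q + v)) ⟩
      suc (suc (q + (q + v)))  ∎))

kaprekar-distinct : .{{_ : NonZero B}} → ∀ {s : DigitString B} {x y} → Gaps s x y → 0 < x → 0 < y →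
  twice± B x ≢ twice± B y → Gaps (kaprekar B s) (twice± B x ⊔ twice± B y) (twice± B x ⊓ twice± B y)
kaprekar-distinct {B} {s} {x} {y} gs 0<x 0<y u≢v with kaprekar-positive-↭ gs 0<x 0<y
... | p , q , B≡₁ , B≡₂ , K↭ with <-cmp (twice± B x) (twice± B y)
... | tri≈ _ u≡v _ = contradiction u≡v u≢v
... | tri< u<v _ _ rewrite m≤n⇒m⊔n≡n (<⇒≤ u<v) | m≤n⇒m⊓n≡m (<⇒≤ u<v) =
  gaps-fromPermutation _ p q (↭-trans K↭ (↭-trans (++-comm (p + _ ∷ p ∷ []) _)
    (prep _ (++-comm (q ∷ []) _)))) (proj₂ inner) (≤-trans (≤-trans (n≤1+n _) (n≤1+n _)) (proj₁ inner))
  where inner = nested-inner p q _ _ (trans (sym B≡₁) B≡₂) u<v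
... | tri> _ _ v<u rewrite m≥n⇒m⊔n≡m (<⇒≤ v<u) | m≥n⇒m⊓n≡n (<⇒≤ v<u) =
  gaps-fromPermutation _ q p (↭-trans K↭ (prep _ (++-comm (p ∷ []) _))) (proj₂ outer) (proj₁ outer)
  where outer = nested-outer p q _ _ (trans (sym B≡₁) B≡₂) v<u

-- Pairs of equal width are translates of each other by one and interleave: the outer gap exceeds
-- the common width by one and the inner gap falls short of it by one.
kaprekar-equal : .{{_ : NonZero B}} → ∀ {s : DigitString B} {x y u} → Gaps s x y → 0 < x → 0 < y →
  twice± B x ≡ suc u → twice± B y ≡ suc u → Gaps (kaprekar B s) (2 + u) u
kaprekar-equal {B} {s} {x} {y} {u} gs 0<x 0<y fx≡ fy≡ with kaprekar-positive-↭ gs 0<x 0<y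
... | p , q , B≡₁ , B≡₂ , K↭ rewrite fx≡ | fy≡ with p≡1+q
  where
  double-+ : ∀ m n → m + (m + n) ≡ 2 * m + n
  double-+ = solve-∀
  double-+-suc : ∀ m n → suc (suc (m + (m + n))) ≡ 2 * suc m + n
  double-+-suc = solve-∀
  p≡1+q : p ≡ suc q
  p≡1+q = *-cancelˡ-≡ p (suc q) 2 (+-cancelʳ-≡ (suc u) _ _
    (trans (sym (double-+ p (suc u))) (trans (trans (sym B≡₁) B≡₂) (double-+-suc q (suc u)))))
... | refl = gaps-fromPermutation _ (suc q) q
  (↭-trans K↭ (↭-trans (↭-reflexive (cong₂ (λ m n → m ∷ suc q ∷ n ∷ q ∷ [])
    (sym (+-suc q (suc u))) (+-suc q u))) (prep _ (swap _ _ ↭-refl))))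
  (≤-trans (n≤1+n _) (≤-reflexive (trans (cong suc (sym (+-suc q u))) (sym (+-suc q (suc u)))))) (n≤1+n q)

-- Doubling odd digits up to sign

∣m-n∣-cases : ∀ m n → m ≡ n + ∣ m - n ∣ ⊎ n ≡ m + ∣ m - n ∣
∣m-n∣-cases zero    n       = inj₂ refl
∣m-n∣-cases (suc m) zero    = inj₁ refl
∣m-n∣-cases (suc m) (suc n) with ∣m-n∣-cases m n
... | inj₁ eq = inj₁ (cong suc eq)
... | inj₂ eq = inj₂ (cong suc eq)

odd⇒≡1+⌊n/2⌋*2 : ∀ {n} → 2 ∤ n → n ≡ 1 + n / 2 * 2
odd⇒≡1+⌊n/2⌋*2 {n} 2∤n with n % 2 in eq | m%n<n n 2 | m≡m%n+[m/n]*n n 2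
... | 0 | _                 | _   = contradiction (m%n≡0⇒n∣m n 2 eq) 2∤n
... | 1 | _                 | n≡ = n≡
... | suc (suc _) | s≤s (s≤s ()) | _

odd+odd : ∀ {m n} → 2 ∤ m → 2 ∤ n → 2 ∣ m + n
odd+odd {m} {n} 2∤m 2∤n = subst (2 ∣_) (sym sum≡) (n∣m*n (suc (m / 2 + n / 2)))
  where
  regroup : ∀ i j → (1 + i * 2) + (1 + j * 2) ≡ suc (i + j) * 2
  regroup = solve-∀
  sum≡ : m + n ≡ suc (m / 2 + n / 2) * 2
  sum≡ = trans (cong₂ _+_ (odd⇒≡1+⌊n/2⌋*2 2∤m) (odd⇒≡1+⌊n/2⌋*2 2∤n)) (regroup (m / 2) (n / 2))

∣m+n∣n⇒∣m : ∀ {d m n} → d ∣ m + n → d ∣ n → d ∣ m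
∣m+n∣n⇒∣m {d} {m} {n} d∣m+n = ∣m+n∣m⇒∣n (subst (d ∣_) (+-comm m n) d∣m+n)

odd⇒>0 : ∀ {n} → 2 ∤ n → 0 < n
odd⇒>0 {zero}  2∤n = contradiction (n∣m*n 0) 2∤n
odd⇒>0 {suc _} _   = s≤s z≤n

-- Odd digits represent the nonzero residues of an odd base up to sign, and
-- twice± B represents doubling.
OddDigit : ℕ → ℕ → Set
OddDigit B a = 2 ∤ a × a < B

twice±-cases : ∀ B a → B ≡ 2 * a + twice± B a ⊎ 2 * a ≡ B + twice± B a
twice±-cases B a = ∣m-n∣-cases B (2 * a)

twice±-odd : ∀ {B} a → 2 ∤ B → 2 ∤ twice± B a
twice±-odd {B} a 2∤B 2∣f with twice±-cases B a
... | inj₁ B≡  = 2∤B (subst (2 ∣_) (sym B≡) (∣m∣n⇒∣m+n (m∣m*n a) 2∣f))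
... | inj₂ 2a≡ = 2∤B (∣m+n∣n⇒∣m (subst (2 ∣_) 2a≡ (m∣m*n a)) 2∣f)

twice±-< : ∀ {B a} → 0 < a → a < B → twice± B a < B
twice±-< {B} {a} 0<a a<B with twice±-cases B a
... | inj₁ B≡  = subst (twice± B a <_) (sym B≡) (m<n+m (twice± B a) (*-mono-< {0} {2} (s≤s z≤n) 0<a))
... | inj₂ 2a≡ = +-cancelˡ-< B _ _ (begin-strict
  B + twice± B a  ≡⟨ 2a≡ ⟨
  2 * a           <⟨ *-monoʳ-< 2 a<B ⟩
  2 * B           ≡⟨ cong (B +_) (+-identityʳ B) ⟩
  B + B           ∎)
  where open ≤-Reasoning

twice±-oddDigit : ∀ {B a} → 2 ∤ B → 0 < a → a < B → OddDigit B (twice± B a)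
twice±-oddDigit {a = a} 2∤B 0<a a<B = twice±-odd a 2∤B , twice±-< 0<a a<B

-- If B - 2a and B - 2b have equal absolute values, equal signs give a = b and opposite signs give
-- 2a + 2b = 2B.
twice±-collision : ∀ {B a b} → twice± B a ≡ twice± B b → a ≡ b ⊎ a + b ≡ B
twice±-collision {B} {a} {b} eq with twice±-cases B a | twice±-cases B b
... | inj₁ p | inj₁ q = inj₁ (*-cancelˡ-≡ a b 2 (+-cancelʳ-≡ (twice± B a) _ _
  (trans (sym p) (trans q (cong (2 * b +_) (sym eq))))))
... | inj₂ p | inj₂ q = inj₁ (*-cancelˡ-≡ a b 2 (trans p (trans (cong (B +_) eq) (sym q))))
... | inj₁ p | inj₂ q = inj₂ (*-cancelˡ-≡ (a + b) B 2 (begin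
  2 * (a + b)               ≡⟨ *-distribˡ-+ 2 a b ⟩
  2 * a + 2 * b             ≡⟨ cong (2 * a +_) (trans q (cong (B +_) (sym eq))) ⟩
  2 * a + (B + twice± B a)  ≡⟨ regroup (2 * a) B (twice± B a) ⟩
  (2 * a + twice± B a) + B  ≡⟨ cong (_+ B) p ⟨
  B + B                     ≡⟨ cong (B +_) (+-identityʳ B) ⟨
  2 * B                     ∎))
  where
  open ≡-Reasoning
  regroup : ∀ i j k → i + (j + k) ≡ (i + k) + j
  regroup = solve-∀
... | inj₂ p | inj₁ q = inj₂ (*-cancelˡ-≡ (a + b) B 2 (begin
  2 * (a + b)               ≡⟨ *-distribˡ-+ 2 a b ⟩
  2 * a + 2 * b             ≡⟨ cong (_+ 2 * b) (trans p (cong (B +_) eq)) ⟩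
  B + twice± B b + 2 * b    ≡⟨ regroup (2 * b) B (twice± B b) ⟩
  B + (2 * b + twice± B b)  ≡⟨ cong (B +_) q ⟨
  B + B                     ≡⟨ cong (B +_) (+-identityʳ B) ⟨
  2 * B                     ∎))
  where
  open ≡-Reasoning
  regroup : ∀ i j k → (j + k) + i ≡ j + (i + k)
  regroup = solve-∀

-- The digits a and B - a have the same image, but for odd B only one of them is odd.
twice±-injective : ∀ {B a b} → 2 ∤ B → OddDigit B a → OddDigit B b → twice± B a ≡ twice± B b → a ≡ b
twice±-injective {B} 2∤B (2∤a , _) (2∤b , _) eq with twice±-collision {B} eq
... | inj₁ a≡b   = a≡b
... | inj₂ a+b≡B = contradiction (subst (2 ∣_) a+b≡B (odd+odd 2∤a 2∤b)) 2∤B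

-- Iteration, least witnesses and the pigeonhole principle

module _ {A : Set} (f : A → A) where

  iterate-+ : ∀ x m n → iterate f x (m + n) ≡ iterate f (iterate f x m) n
  iterate-+ x zero    n = refl
  iterate-+ x (suc m) n = iterate-+ (f x) m n

  iterate-suc : ∀ x n → iterate f x (suc n) ≡ f (iterate f x n)
  iterate-suc x zero    = refl
  iterate-suc x (suc n) = iterate-suc (f x) n

  iterate-* : ∀ x n → iterate f x n ≡ x → ∀ k → iterate f x (k * n) ≡ x
  iterate-* x n eq zero    = refl
  iterate-* x n eq (suc k) = trans (iterate-+ x n (k * n))
    (trans (cong (λ y → iterate f y (k * n)) eq) (iterate-* x n eq k))

least : ∀ {P : ℕ → Set} → (∀ n → Dec (P n)) → ∀ {n} → P n → ∃[ m ] IsLeast P m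
least {P} P? {n} Pn with search n
  where
  search : ∀ n → (∃[ m ] IsLeast P m) ⊎ (∀ k → P k → n ≤ k)
  search zero = inj₂ λ _ _ → z≤n
  search (suc n) with search n
  ... | inj₁ found = inj₁ found
  ... | inj₂ n≤ with P? n
  ...   | yes Pn = inj₁ (n , Pn , n≤)
  ...   | no ¬Pn = inj₂ λ k Pk → ≤∧≢⇒< (n≤ k Pk) λ { refl → ¬Pn Pk }
... | inj₁ found = found
... | inj₂ n≤    = n , Pn , n≤

-- An odd digit is determined by its half rounded down, which is below (B - 1) / 2; the pigeonhole
-- principle applies to these halves.
oddDigit-collision : ∀ {B} → 2 ∤ B → (g : Fin (suc ((B ∸ 1) / 2)) → ℕ) → (∀ i → OddDigit B (g i)) →
  ∃[ i ] ∃[ j ] toℕ i < toℕ j × g i ≡ g j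
oddDigit-collision {B} 2∤B g odd = collision
  where
  half : ℕ
  half = (B ∸ 1) / 2
  B≡ : B ≡ 1 + half * 2
  B≡ = trans (odd⇒≡1+⌊n/2⌋*2 2∤B) (cong (λ k → 1 + k * 2)
    (sym (trans (cong (λ k → (k ∸ 1) / 2) (odd⇒≡1+⌊n/2⌋*2 2∤B)) (m*n/n≡m (B / 2) 2))))
  index< : ∀ i → g i / 2 < half
  index< i = *-cancelʳ-< 2 _ _ (+-cancelˡ-< 1 _ _
    (subst₂ _<_ (odd⇒≡1+⌊n/2⌋*2 (proj₁ (odd i))) B≡ (proj₂ (odd i))))
  collision : ∃[ i ] ∃[ j ] toℕ i < toℕ j × g i ≡ g j
  collision with pigeonhole ≤-refl (λ i → fromℕ< (index< i))
  ... | i , j , i<j , eq = i , j , i<j , trans (odd⇒≡1+⌊n/2⌋*2 (proj₁ (odd i)))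
    (trans (cong (λ k → 1 + k * 2) (fromℕ<-injective _ _ _ _ eq)) (sym (odd⇒≡1+⌊n/2⌋*2 (proj₁ (odd j)))))

-- With d = 1 + 2k, the number a equals da - k(2a).
odd∣2a⇒∣a : ∀ {d a} → 2 ∤ d → d ∣ 2 * a → d ∣ a
odd∣2a⇒∣a {d} {a} 2∤d d∣2a = ∣m+n∣n⇒∣m (subst (d ∣_) (regroup (d / 2) a)
  (subst (λ k → d ∣ k * a) (odd⇒≡1+⌊n/2⌋*2 2∤d) (m∣m*n a))) (∣n⇒∣m*n (d / 2) d∣2a)
  where
  regroup : ∀ k a → (1 + k * 2) * a ≡ a + k * (2 * a)
  regroup = solve-∀

∣twice±⇒∣ : ∀ {B d a} → 2 ∤ d → d ∣ B → d ∣ twice± B a → d ∣ a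
∣twice±⇒∣ {B} {d} {a} 2∤d d∣B d∣f with twice±-cases B a
... | inj₁ B≡  = odd∣2a⇒∣a 2∤d (∣m+n∣n⇒∣m (subst (d ∣_) B≡ d∣B) d∣f)
... | inj₂ 2a≡ = odd∣2a⇒∣a 2∤d (subst (d ∣_) (sym 2a≡) (∣m∣n⇒∣m+n d∣B d∣f))

-- For a = 1 this says that every iterate of 1 is prime to `B`.
∣iterate-twice±⇒∣ : ∀ {B d a} → 2 ∤ d → d ∣ B → ∀ n → d ∣ iterate (twice± B) a n → d ∣ a
∣iterate-twice±⇒∣ 2∤d d∣B zero    d∣ = d∣
∣iterate-twice±⇒∣ 2∤d d∣B (suc n) d∣ = ∣twice±⇒∣ 2∤d d∣B (∣iterate-twice±⇒∣ 2∤d d∣B n d∣)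

module _ {B : ℕ} (2∤B : 2 ∤ B) where

  iterate-twice±-oddDigit : ∀ n {a} → OddDigit B a → OddDigit B (iterate (twice± B) a n)
  iterate-twice±-oddDigit zero    a-odd = a-odd
  iterate-twice±-oddDigit (suc n) (2∤a , a<B) =
    iterate-twice±-oddDigit n (twice±-oddDigit 2∤B (odd⇒>0 2∤a) a<B)

  iterate-twice±-injective : ∀ n {a b} → OddDigit B a → OddDigit B b →
    iterate (twice± B) a n ≡ iterate (twice± B) b n → a ≡ b
  iterate-twice±-injective zero    a-odd b-odd eq = eq
  iterate-twice±-injective (suc n) a-odd b-odd eq = twice±-injective 2∤B a-odd b-odd
    (iterate-twice±-injective n (iterate-twice±-oddDigit 1 a-odd) (iterate-twice±-oddDigit 1 b-odd) eq)

  -- Injectivity on odd digits cancels the `i` common steps, so the orbit has no preperiod.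
  collision⇒return : ∀ {a i j} → OddDigit B a → i < j →
    iterate (twice± B) a i ≡ iterate (twice± B) a j → IsPeriod (twice± B) a (j ∸ i)
  collision⇒return {a} {i} {j} a-odd i<j eq = m<n⇒0<n∸m i<j ,
    sym (iterate-twice±-injective i a-odd (iterate-twice±-oddDigit (j ∸ i) a-odd)
      (trans eq (trans (cong (iterate (twice± B) a) (sym (m∸n+n≡m (<⇒≤ i<j)))) (iterate-+ (twice± B) a (j ∸ i) i))))

  module _ (1<B : 1 < B) where

    one-oddDigit : OddDigit B 1
    one-oddDigit = (λ 2∣1 → contradiction (∣1⇒≡1 2∣1) λ ()) , 1<B

    twice±-period : ∃[ m ] IsLeast (IsPeriod (twice± B) 1) m × m ≤ (B ∸ 1) / 2
    twice±-period with oddDigit-collision 2∤B (λ i → iterate (twice± B) 1 (toℕ i)) (λ i → iterate-twice±-oddDigit (toℕ i) one-oddDigit)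
    ... | i , j , i<j , eq with least (λ n → 0 <? n ×-dec iterate (twice± B) 1 n ≟ 1) (collision⇒return one-oddDigit i<j eq)
    -- The colliding exponents lie between 0 and (B - 1) / 2, hence so does their difference, a
    -- period.
    ... | m , m-least = m , m-least , ≤-trans (proj₂ m-least _ (collision⇒return one-oddDigit i<j eq))
      (≤-trans (m∸n≤m (toℕ j) (toℕ i)) (toℕ≤pred[n] j))

    -- Only units occur in the orbit of 1, so a proper divisor of B cannot lie
    -- in an orbit that contains all odd digits.
    full-period⇒prime : IsLeast (IsPeriod (twice± B) 1) ((B ∸ 1) / 2) → Prime B
    full-period⇒prime (_ , minimal) = prime {{n>1⇒nonTrivial 1<B}} not-composite
      where
      not-composite : ¬ Composite B
      not-composite (composite {d} d<B d∣B) = collide (oddDigit-collision 2∤B g g-odd)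
        where
        2∤d : 2 ∤ d
        2∤d 2∣d = 2∤B (∣-trans 2∣d d∣B)
        -- The divisor `d` and the first (B - 1) / 2 iterates of 1 are one value too many to be
        -- distinct. If `d` is an iterate, it divides 1; if two iterates agree, 1 returns too early.
        g : Fin (suc ((B ∸ 1) / 2)) → ℕ
        g zero    = d
        g (suc i) = iterate (twice± B) 1 (toℕ i)
        g-odd : ∀ i → OddDigit B (g i)
        g-odd zero    = 2∤d , d<B
        g-odd (suc i) = iterate-twice±-oddDigit (toℕ i) one-oddDigit
        collide : ¬ (∃[ i ] ∃[ j ] toℕ i < toℕ j × g i ≡ g j)
        collide (zero , suc j , _ , eq) = contradiction
          (∣1⇒≡1 (∣iterate-twice±⇒∣ 2∤d d∣B (toℕ j) (∣-reflexive eq)))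
          (>⇒≢ (nonTrivial⇒n>1 d))
        collide (suc i , suc j , s≤s i<j , eq) = contradiction
          (minimal _ (collision⇒return one-oddDigit i<j eq))
          (<⇒≱ (≤-<-trans (m∸n≤m (toℕ j) (toℕ i)) (toℕ<n j)))

-- Congruence up to sign and the powers of 2

∣+m-+n∣≡∣m-n∣ : ∀ m n → ℤ.∣ ℤ.+ m ℤ.- ℤ.+ n ∣ ≡ ∣ m - n ∣
∣+m-+n∣≡∣m-n∣ m n = trans (cong ℤ.∣_∣ (ℤ.[+m]-[+n]≡m⊖n m n)) (∣m⊖n∣≡∣m-n∣ m n)
  where
  ∣m⊖n∣≡∣m-n∣ : ∀ m n → ℤ.∣ m ℤ.⊖ n ∣ ≡ ∣ m - n ∣
  ∣m⊖n∣≡∣m-n∣ m n with ≤-total m n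
  ... | inj₁ m≤n = trans (ℤ.∣⊖∣-≤ m≤n) (sym (m≤n⇒∣m-n∣≡n∸m m≤n))
  ... | inj₂ n≤m = trans (ℤ.∣m⊖n∣≡∣n⊖m∣ m n) (trans (ℤ.∣⊖∣-≤ n≤m) (sym (m≤n⇒∣n-m∣≡n∸m n≤m)))

module _ (B : ℕ) where

  infix 4 _≈±_

  -- This is a ≡ ±b modulo `B`, stated over the integers so that differences do not truncate and the
  -- cases combine by ring identities.
  _≈±_ : ℕ → ℕ → Set
  a ≈± b = ℤ.+ B ℤ.∣ ℤ.+ a ℤ.- ℤ.+ b ⊎ ℤ.+ B ℤ.∣ ℤ.+ a ℤ.+ ℤ.+ b

  ≈±-sym : ∀ {a b} → a ≈± b → b ≈± a
  ≈±-sym {a} {b} (inj₁ B∣) = inj₁ (subst (ℤ.+ B ℤ.∣_) (flip (ℤ.+ a) (ℤ.+ b)) (ℤ.∣m⇒∣-m B∣))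
    where
    flip : ∀ i j → ℤ.- (i ℤ.- j) ≡ j ℤ.- i
    flip = ℤ-Solver.solve-∀
  ≈±-sym {a} {b} (inj₂ B∣) = inj₂ (subst (ℤ.+ B ℤ.∣_) (ℤ.+-comm (ℤ.+ a) (ℤ.+ b)) B∣)

  ≈±-trans : ∀ {a b c} → a ≈± b → b ≈± c → a ≈± c
  ≈±-trans {a} {b} {c} (inj₁ p) (inj₁ q) = inj₁ (subst (ℤ.+ B ℤ.∣_) (regroup (ℤ.+ a) (ℤ.+ b) (ℤ.+ c)) (ℤ.∣m∣n⇒∣m+n p q))
    where
    regroup : ∀ i j k → (i ℤ.- j) ℤ.+ (j ℤ.- k) ≡ i ℤ.- k
    regroup = ℤ-Solver.solve-∀
  ≈±-trans {a} {b} {c} (inj₁ p) (inj₂ q) = inj₂ (subst (ℤ.+ B ℤ.∣_) (regroup (ℤ.+ a) (ℤ.+ b) (ℤ.+ c)) (ℤ.∣m∣n⇒∣m+n p q))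
    where
    regroup : ∀ i j k → (i ℤ.- j) ℤ.+ (j ℤ.+ k) ≡ i ℤ.+ k
    regroup = ℤ-Solver.solve-∀
  ≈±-trans {a} {b} {c} (inj₂ p) (inj₁ q) = inj₂ (subst (ℤ.+ B ℤ.∣_) (regroup (ℤ.+ a) (ℤ.+ b) (ℤ.+ c)) (ℤ.∣m∣n⇒∣m-n p q))
    where
    regroup : ∀ i j k → (i ℤ.+ j) ℤ.- (j ℤ.- k) ≡ i ℤ.+ k
    regroup = ℤ-Solver.solve-∀
  ≈±-trans {a} {b} {c} (inj₂ p) (inj₂ q) = inj₁ (subst (ℤ.+ B ℤ.∣_) (regroup (ℤ.+ a) (ℤ.+ b) (ℤ.+ c)) (ℤ.∣m∣n⇒∣m-n p q))
    where
    regroup : ∀ i j k → (i ℤ.+ j) ℤ.- (j ℤ.+ k) ≡ i ℤ.- k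
    regroup = ℤ-Solver.solve-∀

  ≈±-*ˡ : ∀ k {a b} → a ≈± b → k * a ≈± k * b
  ≈±-*ˡ k {a} {b} (inj₁ p) = inj₁ (subst (ℤ.+ B ℤ.∣_)
    (trans (distrib (ℤ.+ k) (ℤ.+ a) (ℤ.+ b)) (cong₂ ℤ._-_ (sym (ℤ.pos-* k a)) (sym (ℤ.pos-* k b))))
    (ℤ.∣n⇒∣m*n (ℤ.+ k) p))
    where
    distrib : ∀ i j k → i ℤ.* (j ℤ.- k) ≡ i ℤ.* j ℤ.- i ℤ.* k
    distrib = ℤ-Solver.solve-∀
  ≈±-*ˡ k {a} {b} (inj₂ p) = inj₂ (subst (ℤ.+ B ℤ.∣_)
    (trans (ℤ.*-distribˡ-+ (ℤ.+ k) (ℤ.+ a) (ℤ.+ b)) (cong₂ ℤ._+_ (sym (ℤ.pos-* k a)) (sym (ℤ.pos-* k b))))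
    (ℤ.∣n⇒∣m*n (ℤ.+ k) p))

  twice±-≈± : ∀ a → twice± B a ≈± 2 * a
  twice±-≈± a with twice±-cases B a
  ... | inj₁ B≡  = inj₂ (ℤ.∣-reflexive (trans (cong ℤ.+_ B≡) (ℤ.+-comm (ℤ.+ (2 * a)) (ℤ.+ twice± B a))))
  ... | inj₂ 2a≡ = ≈±-sym {2 * a} {twice± B a} (inj₁ (ℤ.∣-reflexive
    (sym (trans (cong (λ k → ℤ.+ k ℤ.- ℤ.+ twice± B a) 2a≡) (cancel (ℤ.+ B) (ℤ.+ twice± B a))))))
    where
    cancel : ∀ i j → (i ℤ.+ j) ℤ.- j ≡ i
    cancel = ℤ-Solver.solve-∀

  iterate-twice±-≈± : ∀ a n → iterate (twice± B) a n ≈± 2 ^ n * a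
  iterate-twice±-≈± a zero    = subst (a ≈±_) (sym (+-identityʳ a))
    (inj₁ (subst (ℤ.+ B ℤ.∣_) (sym (ℤ.+-inverseʳ (ℤ.+ a))) (ℤ.divides (ℤ.+ 0) refl)))
  iterate-twice±-≈± a (suc n) = subst (iterate (twice± B) a (suc n) ≈±_) (regroup (2 ^ n) a)
    (≈±-trans {b = 2 ^ n * twice± B a} (iterate-twice±-≈± (twice± B a) n) (≈±-*ˡ (2 ^ n) {twice± B a} {2 * a} (twice±-≈± a)))
    where
    regroup : ∀ k a → k * (2 * a) ≡ 2 * k * a
    regroup = solve-∀

  -- A difference divisible by `B` has absolute value below `B` and is 0. A sum divisible by `B` is
  -- positive and below 2B, so it would be `B`, but it is even.
  ≈±⇒≡ : 2 ∤ B → ∀ {a b} → OddDigit B a → OddDigit B b → a ≈± b → a ≡ b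
  ≈±⇒≡ 2∤B {a} {b} (2∤a , a<B) (2∤b , b<B) (inj₁ B∣) with ∣ a - b ∣ in eq | subst (B ∣_) (∣+m-+n∣≡∣m-n∣ a b) (ℤ.∣⇒∣ᵤ B∣)
  ... | zero  | _   = ∣m-n∣≡0⇒m≡n eq
  ... | suc k | B∣k = contradiction (∣⇒≤ B∣k)
    (<⇒≱ (subst (_< B) eq (≤-<-trans (∣m-n∣≤m⊔n a b) (⊔-lub a<B b<B))))
  ≈±⇒≡ 2∤B {a} {b} (2∤a , a<B) (2∤b , b<B) (inj₂ B∣) with ℤ.∣⇒∣ᵤ B∣
  ... | B∣a+b = contradiction (subst (2 ∣_) a+b≡B (odd+odd 2∤a 2∤b)) 2∤B
    where
    a+b≡B : a + b ≡ B
    a+b≡B = multiple B∣a+b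
      where
      multiple : B ∣ a + b → a + b ≡ B
      multiple (divides 0 eq) = contradiction (subst (0 <_) eq (<-≤-trans (odd⇒>0 2∤a) (m≤m+n a b))) λ ()
      multiple (divides 1 eq) = trans eq (+-identityʳ B)
      multiple (divides (suc (suc q)) eq) = contradiction (+-mono-< a<B b<B) (≤⇒≯ (begin
        B + B            ≤⟨ +-monoʳ-≤ B (m≤m+n B (q * B)) ⟩
        B + (B + q * B)  ≡⟨ eq ⟨
        a + b            ∎))
        where open ≤-Reasoning

  2^n≈±1⇔ : ∀ n → 2 ^ n ≈± 1 ⇔ TwoPower≡±1 B n
  2^n≈±1⇔ n = mk⇔ to from
    where
    ∣2^n-1∣≡ : ℤ.∣ ℤ.+ (2 ^ n) ℤ.- ℤ.+ 1 ∣ ≡ 2 ^ n ∸ 1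
    ∣2^n-1∣≡ = trans (∣+m-+n∣≡∣m-n∣ (2 ^ n) 1) (m≤n⇒∣n-m∣≡n∸m (m^n>0 2 n))
    to : 2 ^ n ≈± 1 → TwoPower≡±1 B n
    to (inj₁ B∣) = inj₁ (subst (B ∣_) ∣2^n-1∣≡ (ℤ.∣⇒∣ᵤ B∣))
    to (inj₂ B∣) = inj₂ (ℤ.∣⇒∣ᵤ B∣)
    from : TwoPower≡±1 B n → 2 ^ n ≈± 1
    from (inj₁ B∣) = inj₁ (ℤ.∣ᵤ⇒∣ (subst (B ∣_) (sym ∣2^n-1∣≡) B∣))
    from (inj₂ B∣) = inj₂ (ℤ.∣ᵤ⇒∣ B∣)

module _ {B : ℕ} (2∤B : 2 ∤ B) (1<B : 1 < B) where

  iterate-twice±-one-≈± : ∀ n → _≈±_ B (iterate (twice± B) 1 n) (2 ^ n)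
  iterate-twice±-one-≈± n = subst (_≈±_ B _) (*-identityʳ (2 ^ n)) (iterate-twice±-≈± B 1 n)

  -- The `n`-th iterate of 1 is congruent to ±2ⁿ, and the only odd digit congruent to ±1 is 1.
  isPeriod-twice±⇔ : ∀ n → IsPeriod (twice± B) 1 n ⇔ (0 < n × TwoPower≡±1 B n)
  isPeriod-twice±⇔ n = mk⇔
    (λ (0<n , eq) → 0<n , Equivalence.to (2^n≈±1⇔ B n)
      (≈±-sym B {1} {2 ^ n} (subst (λ k → _≈±_ B k (2 ^ n)) eq (iterate-twice±-one-≈± n))))
    (λ (0<n , 2^n≡±1) → 0<n , ≈±⇒≡ B 2∤B (iterate-twice±-oddDigit 2∤B n (one-oddDigit 2∤B 1<B)) (one-oddDigit 2∤B 1<B)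
      (≈±-trans B {b = 2 ^ n} (iterate-twice±-one-≈± n) (Equivalence.from (2^n≈±1⇔ B n) 2^n≡±1)))

  -- The `n`-th iterate of `a` is congruent to ±2ⁿa, so a period of 1 serves every odd digit.
  isPeriod-twice±⇒iterate≡ : ∀ {n a} → IsPeriod (twice± B) 1 n → OddDigit B a → iterate (twice± B) a n ≡ a
  isPeriod-twice±⇒iterate≡ {n} {a} (_ , eq) a-odd = ≈±⇒≡ B 2∤B (iterate-twice±-oddDigit 2∤B n a-odd) a-odd
    (≈±-trans B {b = 2 ^ n * a} (iterate-twice±-≈± B a n) (subst₂ (_≈±_ B) (*-comm a (2 ^ n)) (*-identityʳ a)
      (≈±-*ˡ B a {2 ^ n} {1} (≈±-sym B {1} {2 ^ n} (subst (λ k → _≈±_ B k (2 ^ n)) eq (iterate-twice±-one-≈± n))))))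

-- Cycles

⊔-⊓-determine : ∀ {a b c d} → a ⊔ b ≡ c ⊔ d → a ⊓ b ≡ c ⊓ d → (a ≡ c × b ≡ d) ⊎ (a ≡ d × b ≡ c)
⊔-⊓-determine {a} {b} {c} {d} eq⊔ eq⊓ with ≤-total a b | ≤-total c d
... | inj₁ a≤b | inj₁ c≤d rewrite m≤n⇒m⊔n≡n a≤b | m≤n⇒m⊓n≡m a≤b | m≤n⇒m⊔n≡n c≤d | m≤n⇒m⊓n≡m c≤d = inj₁ (eq⊓ , eq⊔)
... | inj₁ a≤b | inj₂ d≤c rewrite m≤n⇒m⊔n≡n a≤b | m≤n⇒m⊓n≡m a≤b | m≥n⇒m⊔n≡m d≤c | m≥n⇒m⊓n≡n d≤c = inj₂ (eq⊓ , eq⊔)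
... | inj₂ b≤a | inj₁ c≤d rewrite m≥n⇒m⊔n≡m b≤a | m≥n⇒m⊓n≡n b≤a | m≤n⇒m⊔n≡n c≤d | m≤n⇒m⊓n≡m c≤d = inj₂ (eq⊔ , eq⊓)
... | inj₂ b≤a | inj₂ d≤c rewrite m≥n⇒m⊔n≡m b≤a | m≥n⇒m⊓n≡n b≤a | m≥n⇒m⊔n≡m d≤c | m≥n⇒m⊓n≡n d≤c = inj₁ (eq⊔ , eq⊓)

DistinctOddDigits : ℕ → ℕ → ℕ → Set
DistinctOddDigits B a b = OddDigit B a × OddDigit B b × a ≢ b

-- Doubling does not respect the order of the two gaps. They are therefore followed separately, and
-- maximum and minimum are taken only to compare them with a string.
GapPair : DigitString B → ℕ → ℕ → Set
GapPair s a b = Gaps s (a ⊔ b) (a ⊓ b)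

-- Pairs are compared as unordered ones: the two members may also be exchanged, as happens for B = 5
-- and m = 1.
PreservesPairs : ℕ → ℕ → Set
PreservesPairs B m = ∀ {a b} → DistinctOddDigits B a b →
  iterate (twice± B) a m ⊔ iterate (twice± B) b m ≡ a ⊔ b × iterate (twice± B) a m ⊓ iterate (twice± B) b m ≡ a ⊓ b

module _ {B : ℕ} .{{_ : NonZero B}} (2∤B : 2 ∤ B) (3<B : 3 < B) where

  private
    K : DigitString B → DigitString B
    K = kaprekar B

    f : ℕ → ℕ
    f = twice± B

  twice±-distinct : ∀ {a b} → DistinctOddDigits B a b → DistinctOddDigits B (f a) (f b)
  twice±-distinct (a-odd , b-odd , a≢b) =
    iterate-twice±-oddDigit 2∤B 1 a-odd , iterate-twice±-oddDigit 2∤B 1 b-odd ,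
    λ eq → a≢b (twice±-injective 2∤B a-odd b-odd eq)

  kaprekar-pair : ∀ {s a b} → DistinctOddDigits B a b → GapPair s a b → GapPair (K s) (f a) (f b)
  kaprekar-pair {s} {a} {b} ds@((2∤a , _) , (2∤b , _) , _) gs with ≤-total a b
  ... | inj₂ b≤a rewrite m≥n⇒m⊔n≡m b≤a | m≥n⇒m⊓n≡n b≤a =
    kaprekar-distinct gs (odd⇒>0 2∤a) (odd⇒>0 2∤b) (proj₂ (proj₂ (twice±-distinct ds)))
  ... | inj₁ a≤b rewrite m≤n⇒m⊔n≡n a≤b | m≤n⇒m⊓n≡m a≤b | ⊔-comm (f a) (f b) | ⊓-comm (f a) (f b) =
    kaprekar-distinct gs (odd⇒>0 2∤b) (odd⇒>0 2∤a) (λ eq → proj₂ (proj₂ (twice±-distinct ds)) (sym eq))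

  iterate-distinct : ∀ n {a b} → DistinctOddDigits B a b → DistinctOddDigits B (iterate f a n) (iterate f b n)
  iterate-distinct zero    ds = ds
  iterate-distinct (suc n) ds = iterate-distinct n (twice±-distinct ds)

  iterate-pair : ∀ n {s a b} → DistinctOddDigits B a b → GapPair s a b →
    GapPair (iterate K s n) (iterate f a n) (iterate f b n)
  iterate-pair zero    ds gs = gs
  iterate-pair (suc n) ds gs = iterate-pair n (twice±-distinct ds) (kaprekar-pair ds gs)

  -- Reaching two distinct odd gaps

  ReachesPair : DigitString B → Set
  ReachesPair s = ∃[ n ] ∃[ a ] ∃[ b ] DistinctOddDigits B a b × GapPair (iterate K s n) a b

  reaches-step : ∀ {s} → ReachesPair (K s) → ReachesPair s
  reaches-step (n , r) = suc n , r

  reaches-distinct : ∀ {s x y} → Gaps s x y → 0 < y → f x ≢ f y → ReachesPair s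
  reaches-distinct {x = x} {y} gs 0<y fx≢fy = 1 , f x , f y ,
    (twice±-oddDigit 2∤B 0<x (outer<B gs) ,
     twice±-oddDigit 2∤B 0<y (≤-<-trans (inner≤outer gs) (outer<B gs)) , fx≢fy) ,
    kaprekar-distinct gs 0<x 0<y fx≢fy
    where
    0<x : 0 < x
    0<x = <-≤-trans 0<y (inner≤outer gs)

  private
    odd-minus-two : ∀ {b} → suc (suc b) ≡ B → OddDigit B b × 1 ≢ b
    odd-minus-two {b} refl = ((λ 2∣b → 2∤B (∣m∣n⇒∣m+n (divides 1 refl) 2∣b)) , n≤1+n (suc b)) ,
      λ { refl → contradiction 3<B (<-irrefl refl) }

    one-odd : OddDigit B 1
    one-odd = one-oddDigit 2∤B (<-trans (s≤s (s≤s z≤n)) 3<B)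

    B-2+2≡B : suc (suc (B ∸ 2)) ≡ B
    B-2+2≡B = m+[n∸m]≡n (<⇒≤ (<-trans (s≤s (s≤s (s≤s z≤n))) 3<B))

  reaches-two-zero : ∀ {s} → Gaps s 2 0 → ReachesPair s
  reaches-two-zero gs = 1 , 1 , B ∸ 2 , (one-odd , odd-minus-two B-2+2≡B) , kaprekar-zero gs B-2+2≡B

  -- The gaps become B - 1 and 0, then B - 2 and 1.
  reaches-one-zero : ∀ {s} → Gaps s 1 0 → ReachesPair s
  reaches-one-zero {s} gs = 2 , B ∸ 2 , 1 ,
    (proj₁ (odd-minus-two B-2+2≡B) , one-odd , λ eq → proj₂ (odd-minus-two B-2+2≡B) (sym eq)) ,
    kaprekar-zero (kaprekar-zero {g = suc (B ∸ 2)} gs B-2+2≡B) (trans (+-comm _ 1) B-2+2≡B)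

  -- If the two images agree, their common value is odd, hence some `suc u`, and the next gaps are u
  -- + 2 and u. For u > 0 these have an even sum, which cannot be `B`, so their images differ; u = 0
  -- leaves the gaps 2 and 0.
  reaches-positive : ∀ {s x y} → Gaps s x y → 0 < y → ReachesPair s
  reaches-positive {s} {x} {y} gs 0<y with f x ≟ f y
  ... | no  fx≢fy = reaches-distinct gs 0<y fx≢fy
  ... | yes fx≡fy with f x in fx≡ | odd⇒>0 (twice±-odd {B} x 2∤B)
  ... | suc u | _ = reaches-step
    (after u (kaprekar-equal gs (<-≤-trans 0<y (inner≤outer gs)) 0<y fx≡ (sym fx≡fy)))
    where
    after : ∀ u → Gaps (K s) (2 + u) u → ReachesPair (K s)
    after zero    gs′ = reaches-two-zero gs′
    after (suc u) gs′ = reaches-distinct gs′ (s≤s z≤n) distinct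
      where
      regroup : ∀ u → (2 + suc u) + suc u ≡ (2 + u) * 2
      regroup = solve-∀
      distinct : f (2 + suc u) ≢ f (suc u)
      distinct eq with twice±-collision {B} eq
      ... | inj₁ 2+u≡u = contradiction 2+u≡u (>⇒≢ (m<n+m (suc u) {2} (s≤s z≤n)))
      ... | inj₂ sum≡B = 2∤B (subst (2 ∣_) (trans (sym (regroup u)) sum≡B) (n∣m*n (2 + u)))

  reaches-pair : ∀ {s x y} → Gaps s x y → 0 < x → ReachesPair s
  reaches-pair {y = suc _} gs _ = reaches-positive gs (s≤s z≤n)
  reaches-pair {s} {x = suc zero}    {zero} gs _ = reaches-one-zero gs
  -- The next gaps are x - 1 and B - x in some order, both positive since 2 ≤ x < B.
  reaches-pair {s} {x = suc (suc p)} {zero} gs _ =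
    reaches-step (reaches-positive (kaprekar-zero gs (m+[n∸m]≡n (<⇒≤ (outer<B gs))))
      (⊓-glb (s≤s z≤n) (m<n⇒0<n∸m (outer<B gs))))

  -- Cycle lengths from periods of gap pairs

  kaprekar-iterate : ∀ m {s a b} → PreservesPairs B m → DistinctOddDigits B a b → GapPair s a b →
    K (iterate K s m) ≡ K s
  kaprekar-iterate m {s} preserves ds gs =
    kaprekar-cong (subst₂ (Gaps (iterate K s m)) (proj₁ (preserves ds)) (proj₂ (preserves ds)) (iterate-pair m ds gs)) gs

  cycleLength≤ : ∀ {m} → 0 < m → PreservesPairs B m → ∀ k → IsTerminalCycleLength B k → k ≤ m
  cycleLength≤ {m} 0<m preserves (suc k) (s , nonConst , (_ , period) , minimal) with hasGaps s
  ... | zero , _ , gs = contradiction (kaprekar-constant gs) (nonConst 1)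
  ... | suc _ , _ , gs with reaches-pair gs (s≤s z≤n)
  ... | n , a , b , ds , gs′ = minimal m (0<m , (begin
    iterate K s m                                  ≡⟨ cong (λ t → iterate K t m) s≡ ⟨
    iterate K (iterate K s (n + (1 + r))) m        ≡⟨ iterate-+ K s (n + (1 + r)) m ⟨
    iterate K s (n + (1 + r) + m)                  ≡⟨ cong (iterate K s) (regroup n r m) ⟩
    iterate K s (n + (m + (1 + r)))                ≡⟨ iterate-+ K s n (m + (1 + r)) ⟩
    iterate K t (m + (1 + r))                      ≡⟨ iterate-+ K t m (1 + r) ⟩
    iterate K (K (iterate K t m)) r                ≡⟨ cong (λ t → iterate K t r) (kaprekar-iterate m preserves ds gs′) ⟩
    iterate K t (1 + r)                            ≡⟨ iterate-+ K s n (1 + r) ⟨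
    iterate K s (n + (1 + r))                      ≡⟨ s≡ ⟩
    s                                              ∎))
    where
    open ≡-Reasoning
    t = iterate K s n
    -- With this `r`, the number n + (1 + r) is the multiple (1 + n)(1 + k) of the period and
    -- exceeds `n`. The step after `t` is the one at which `m` additional steps are absorbed.
    r = k + n * k
    regroup : ∀ n r m → n + (1 + r) + m ≡ n + (m + (1 + r))
    regroup = solve-∀
    expand : ∀ n k → n + (1 + (k + n * k)) ≡ suc n * suc k
    expand = solve-∀
    s≡ : iterate K s (n + (1 + r)) ≡ s
    s≡ = trans (cong (iterate K s) (expand n k)) (iterate-* K s (suc k) period (suc n))

  pair-nonConstant : ∀ {s : DigitString B} {a b} → DistinctOddDigits B a b → GapPair s a b → NonConstant s
  pair-nonConstant {a = a} {b} ((2∤a , _) , _) gs (_ , s≡) =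
    contradiction (constant⇒outer≡0 s≡ gs) (>⇒≢ (<-≤-trans (odd⇒>0 2∤a) (m≤m⊔n a b)))

  isTerminalCycleLength : ∀ {m} {s : DigitString B} {a b} →
    DistinctOddDigits B a b → GapPair s a b → 0 < m → PreservesPairs B m →
    (∀ j → 0 < j → iterate f a j ⊔ iterate f b j ≡ a ⊔ b →
      iterate f a j ⊓ iterate f b j ≡ a ⊓ b → m ≤ j) →
    IsTerminalCycleLength B m
  isTerminalCycleLength {m@(suc m′)} {s} {a} {b} ds gs 0<m preserves minimal =
    t , (λ i → pair-nonConstant (iterate-distinct i ds) (iterate-pair i ds gt)) ,
    (0<m , cong (λ u → iterate K u m′) (kaprekar-iterate m preserves ds gs)) ,
    λ j (0<j , period) →
      let gj = subst (λ u → GapPair u (iterate f a j) (iterate f b j)) period (iterate-pair j ds gt)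
          eqs = gaps-unique gj gt
      in minimal j 0<j (proj₁ eqs) (proj₂ eqs)
    where
    -- The string `s` has the right gaps but need not be periodic. Its `m`-th iterate `t` has the
    -- same gaps and the same image, so `m` steps from `t` end where `m` steps from `s` do, at `t`.
    t = iterate K s m
    gt : GapPair t a b
    gt = subst₂ (Gaps t) (proj₁ (preserves ds)) (proj₂ (preserves ds)) (iterate-pair m ds gs)

-- A string with gaps 1 and B - 2

module _ (b : ℕ) where

  private
    base : ℕ
    base = 4 + b

  -- The digits are B - 2, 1, 0, 0, whose gaps are the double B - 2 of 1 and 1 itself.
  seed : DigitString base
  seed = toDigitString base ((((2 + b) * base + 1) * base + 0) * base + 0)

  seed-pair : GapPair seed 1 (twice± base 1)
  seed-pair = gaps-fromPermutation seed 0 0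
    (↭-reflexive (digitValues-toDigitString (n≤1+n (3 + b)) (s≤s (s≤s z≤n)) (s≤s z≤n) (s≤s z≤n)))
    (s≤s z≤n) z≤n

  seed-distinct : 2 ∤ base → DistinctOddDigits base 1 (twice± base 1)
  seed-distinct 2∤B = one-odd , iterate-twice±-oddDigit 2∤B 1 one-odd , λ ()
    where
    one-odd : OddDigit base 1
    one-odd = one-oddDigit 2∤B (s≤s (s≤s z≤n))

-- Base five

oddDigit-five : ∀ {a} → OddDigit 5 a → a ≡ 1 ⊎ a ≡ 3
oddDigit-five {0} (2∤a , _) = contradiction (divides 0 refl) 2∤a
oddDigit-five {1} _         = inj₁ refl
oddDigit-five {2} (2∤a , _) = contradiction (divides 1 refl) 2∤a
oddDigit-five {3} _         = inj₂ refl
oddDigit-five {4} (2∤a , _) = contradiction (divides 2 refl) 2∤a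
oddDigit-five {suc (suc (suc (suc (suc _))))} (_ , s≤s (s≤s (s≤s (s≤s (s≤s ())))))

preservesPairs-five : PreservesPairs 5 1
preservesPairs-five (a-odd , b-odd , a≢b) with oddDigit-five a-odd | oddDigit-five b-odd
... | inj₁ refl | inj₁ refl = contradiction refl a≢b
... | inj₁ refl | inj₂ refl = refl , refl
... | inj₂ refl | inj₁ refl = refl , refl
... | inj₂ refl | inj₂ refl = contradiction refl a≢b

largestCycleLength-five : 2 ∤ 5 → IsLargest (IsTerminalCycleLength 5) 1
largestCycleLength-five 2∤5 =
  isTerminalCycleLength 2∤5 3<5 (seed-distinct 1 2∤5) (seed-pair 1) (s≤s z≤n) preservesPairs-five
    (λ _ 0<j _ _ → 0<j) ,
  cycleLength≤ 2∤5 3<5 (s≤s z≤n) preservesPairs-five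
  where
  3<5 : 3 < 5
  3<5 = s≤s (s≤s (s≤s (s≤s z≤n)))

-- Bases from seven on

module _ (b : ℕ) (2∤B : 2 ∤ 7 + b) where

  private
    base : ℕ
    base = 7 + b

    1<base : 1 < base
    1<base = s≤s (s≤s z≤n)

    3<base : 3 < base
    3<base = s≤s (s≤s (s≤s (s≤s z≤n)))

  -- A base of at least 7 divides neither 3 nor 5. This rules out that the pair of 1 and B - 2
  -- returns with its members exchanged.
  ¬isPeriod-two : ¬ IsPeriod (twice± base) 1 2
  ¬isPeriod-two period = large (proj₂ (Equivalence.to (isPeriod-twice±⇔ 2∤B 1<base 2) period))
    where
    large : ¬ TwoPower≡±1 base 2
    large (inj₁ B∣3) = contradiction (∣⇒≤ B∣3) λ { (s≤s (s≤s (s≤s ()))) }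
    large (inj₂ B∣5) = contradiction (∣⇒≤ B∣5) λ { (s≤s (s≤s (s≤s (s≤s (s≤s ()))))) }

  largestCycleLength : ∀ {m} → IsLeast (IsPeriod (twice± base) 1) m → IsLargest (IsTerminalCycleLength base) m
  largestCycleLength {m} (period@(0<m , _) , minimal) =
    isTerminalCycleLength 2∤B 3<base (seed-distinct (3 + b) 2∤B) (seed-pair (3 + b)) 0<m preserves returns ,
    cycleLength≤ 2∤B 3<base 0<m preserves
    where
    preserves : PreservesPairs base m
    preserves (a-odd , b-odd , _) =
      cong₂ _⊔_ (isPeriod-twice±⇒iterate≡ 2∤B 1<base period a-odd) (isPeriod-twice±⇒iterate≡ 2∤B 1<base period b-odd) ,
      cong₂ _⊓_ (isPeriod-twice±⇒iterate≡ 2∤B 1<base period a-odd) (isPeriod-twice±⇒iterate≡ 2∤B 1<base period b-odd)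
    -- If j steps swapped 1 and its double, then doubling twice would fix 1.
    returns : ∀ j → 0 < j →
      iterate (twice± base) 1 j ⊔ iterate (twice± base) (twice± base 1) j ≡ 1 ⊔ twice± base 1 →
      iterate (twice± base) 1 j ⊓ iterate (twice± base) (twice± base 1) j ≡ 1 ⊓ twice± base 1 → m ≤ j
    returns j 0<j eq⊔ eq⊓ with ⊔-⊓-determine {iterate (twice± base) 1 j} {iterate (twice± base) (twice± base 1) j} eq⊔ eq⊓
    ... | inj₁ (fixed , _)     = minimal j (0<j , fixed)
    ... | inj₂ (fʲ1≡f1 , fʲ⁺¹1≡1) = contradiction (s≤s z≤n , (begin
      twice± base (twice± base 1)               ≡⟨ cong (twice± base) fʲ1≡f1 ⟨
      twice± base (iterate (twice± base) 1 j)   ≡⟨ iterate-suc (twice± base) 1 j ⟨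
      iterate (twice± base) (twice± base 1) j   ≡⟨ fʲ⁺¹1≡1 ⟩
      1                                         ∎)) ¬isPeriod-two
      where open ≡-Reasoning

  -- Periods of 1 are the positive exponents with 2ⁿ ≡ ±1, so minimality transfers. Primality comes
  -- from `full-period⇒prime`; conversely, minimality of (B - 1) / 2 supplies the inequality
  -- opposite to the given bound.
  fullPeriod⇔ : ∀ {m} → IsLeast (IsPeriod (twice± base) 1) m → m ≤ (base ∸ 1) / 2 →
    m ≡ (base ∸ 1) / 2 ⇔
      (base ≥ 7 × Prime base × IsLeast (λ n → 0 < n × TwoPower≡±1 base n) ((base ∸ 1) / 2))
  fullPeriod⇔ {m} m-least@(period , _) m≤ = mk⇔ to from
    where
    module Period n = Equivalence (isPeriod-twice±⇔ 2∤B 1<base n)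
    to : m ≡ (base ∸ 1) / 2 → _
    to refl = m≤m+n 7 b , full-period⇒prime 2∤B 1<base m-least ,
      Period.to m period , λ n 2ⁿ≡±1 → proj₂ m-least n (Period.from n 2ⁿ≡±1)
    from : _ → m ≡ (base ∸ 1) / 2
    from (_ , _ , _ , minimal) = ≤-antisym m≤ (minimal m (Period.to m period))

corollary1p2 : ∀ (B : ℕ) .{{_ : NonZero B}} → B > 3 → 2 ∤ B →
    ∃[ cmax ] IsLargest (IsTerminalCycleLength B) cmax
    × cmax ≤ (B ∸ 1) / 2
    × (cmax ≡ (B ∸ 1) / 2 ⇔
    (B ≥ 7 × Prime B × IsLeast (λ m → 0 < m × TwoPower≡±1 B m) ((B ∸ 1) / 2)))
corollary1p2 0 () _
corollary1p2 1 (s≤s ()) _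
corollary1p2 2 (s≤s (s≤s ())) _
corollary1p2 3 (s≤s (s≤s (s≤s ()))) _
corollary1p2 4 _ 2∤4 = contradiction (divides 2 refl) 2∤4
corollary1p2 5 _ 2∤5 = 1 , largestCycleLength-five 2∤5 , s≤s z≤n ,
  -- Both sides are false: the largest length 1 is not (5 - 1) / 2 = 2, and 5 is below 7.
  mk⇔ (λ ()) λ { (s≤s (s≤s (s≤s (s≤s (s≤s ())))) , _) }
corollary1p2 6 _ 2∤6 = contradiction (divides 3 refl) 2∤6
corollary1p2 (suc (suc (suc (suc (suc (suc (suc b))))))) _ 2∤B =
  let m , m-least , m≤ = twice±-period 2∤B (s≤s (s≤s z≤n)) in
  m , largestCycleLength b 2∤B m-least , m≤ , fullPeriod⇔ b 2∤B m-least m≤
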